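{- We have $E_{Q_5,Q_5}=7$.
   Context: $\mathbb Z_5=\mathbb Z/5\mathbb Z$ and $Q_5=\{1,-1\}$ is the set of non-zero squares in $\mathbb Z_5$. A sequence of length $k$ in $\mathbb Z_5$ is an element of $\mathbb Z_5^k$. A sequence $(x_1,\ldots,x_k)$ in $\mathbb Z_5$ is called a $(Q_5,Q_5)$-weighted zero-sum sequence if there exist $a_1,\ldots,a_k\in Q_5$ and $b_1,\ldots,b_k\in Q_5$ such that $a_1x_1+\cdots+a_kx_k=0$ and $b_1a_1+\cdots+b_ka_k=0$ in $\mathbb Z_5$. The constant $E_{Q_5,Q_5}$ is the least positive integer $k$ such that every sequence in $\mathbb Z_5$ of length $k$ has a $(Q_5,Q_5)$-weighted zero-sum subsequence of length $5$ (terms not necessarily consecutive). -}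

module Defs where

open import Data.Fin using (Fin; toℕ)
open import Data.Fin.Patterns using (0F)
open import Data.List.Relation.Binary.Sublist.Propositional using (_⊆_)
import Data.Nat as ℕ
open import Data.Nat using (ℕ; _≤_)
open import Data.Nat.DivMod using (_mod_)
open import Data.Product using (_×_; ∃-syntax)
open import Data.Vec using (Vec; foldr′; zipWith; toList)
open import Data.Vec.Relation.Unary.All using (All)
open import Level using (0ℓ)
open import Relation.Binary.PropositionalEquality using (_≡_; _≢_)
open import Relation.Unary using (Pred)

-- ℤ/5ℤ, each class being given by its representative in {0,…,4}.
ℤ₅ : Set
ℤ₅ = Fin 5

infixl 6 _+_
infixl 7 _*_ _·_

_+_ : ℤ₅ → ℤ₅ → ℤ₅
x + y = (toℕ x ℕ.+ toℕ y) mod 5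

_*_ : ℤ₅ → ℤ₅ → ℤ₅
x * y = (toℕ x ℕ.* toℕ y) mod 5

_·_ : ∀ {k} → Vec ℤ₅ k → Vec ℤ₅ k → ℤ₅
a · x = foldr′ _+_ 0F (zipWith _*_ a x)

-- The non-zero squares of ℤ/5ℤ, that is, {1, -1} = {1F, 4F}.
Q₅ : Pred ℤ₅ 0ℓ
Q₅ x = x ≢ 0F × ∃[ y ] x ≡ y * y

WeightedZeroSum : (A B : Pred ℤ₅ 0ℓ) → ∀ {k} → Vec ℤ₅ k → Set
WeightedZeroSum A B {k} x =
  ∃[ a ] ∃[ b ] All A {k} a × All B {k} b × a · x ≡ 0F × b · a ≡ 0F

-- Sublists allow the terms of y to be non-consecutive in x, and use each
-- position of x at most once.
HasWeightedZeroSum₅ : (A B : Pred ℤ₅ 0ℓ) → ∀ {k} → Vec ℤ₅ k → Set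
HasWeightedZeroSum₅ A B x =
  ∃[ y ] toList {n = 5} y ⊆ toList x × WeightedZeroSum A B y

IsLeastPositive : Pred ℕ 0ℓ → Pred ℕ 0ℓ
IsLeastPositive P k = 1 ≤ k × P k × (∀ j → 1 ≤ j → P j → k ≤ j)

-- The constant E_{A,B}, as the relation "E_{A,B} = k".
E[_,_]≡_ : (A B : Pred ℤ₅ 0ℓ) → Pred ℕ 0ℓ
E[ A , B ]≡ k =
  IsLeastPositive (λ j → (x : Vec ℤ₅ j) → HasWeightedZeroSum₅ A B x) k

{-# OPTIONS --safe #-}
-- Every a ∈ Q₅⁵ satisfies a · a = 5 = 0, so b = a always meets the second
-- condition and only a · y = 0 matters. Whether some signed 5-term subsequence
-- sums to 0 depends only on the terms up to sign, so for length 7 it suffices to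
-- check the 3⁷ sequences with terms in {0, 1, 2}. The sequence (0, 0, 0, 0, 1, 2)
-- and its initial segments show that no smaller length works.
module Submission where

open import Defs

open import Data.Empty using (⊥)
open import Data.Fin using (Fin; _↑ˡ_)
open import Data.Fin.Patterns
open import Data.Fin.Properties using (_≟_; all?)
open import Data.List using (List; []; _∷_)
open import Data.List.Relation.Binary.Sublist.Propositional
  using (_⊆_; []; _∷_; _∷ʳ_; minimum; ⊆-trans)
open import Data.List.Relation.Binary.Pointwise using (Pointwise; []; _∷_)
open import Data.Nat using (ℕ; zero; suc; _≤_; z≤n; s≤s)
open import Data.Nat.Properties using (≮⇒≥)
open import Data.Product using (_×_; _,_; ∃-syntax; Σ-syntax)
open import Data.Sum as ⊎ using (_⊎_; inj₁; inj₂)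
open import Data.Vec using (Vec; []; _∷_; map; toList; truncate)
open import Data.Vec.Relation.Unary.All using (All; []; _∷_)
open import Relation.Binary.PropositionalEquality
  using (_≡_; refl; sym; trans; subst)
open import Relation.Nullary using (Dec; no; ¬_)
open import Relation.Nullary.Decidable using (from-yes; from-no; _⊎-dec_; map′)
open import Relation.Unary using (Pred; Decidable)

+-assoc : ∀ x y z → x + y + z ≡ x + (y + z)
+-assoc = from-yes (all? λ x → all? λ y → all? λ z → x + y + z ≟ x + (y + z))

*-assoc : ∀ x y z → x * y * z ≡ x * (y * z)
*-assoc = from-yes (all? λ x → all? λ y → all? λ z → x * y * z ≟ x * (y * z))

+-identityˡ : ∀ x → 0F + x ≡ x
+-identityˡ = from-yes (all? λ x → 0F + x ≟ x)

+-identityʳ : ∀ x → x + 0F ≡ x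
+-identityʳ = from-yes (all? λ x → x + 0F ≟ x)

1∈Q₅ : Q₅ 1F
1∈Q₅ = (λ ()) , 1F , refl

4∈Q₅ : Q₅ 4F
4∈Q₅ = (λ ()) , 2F , refl

Q₅⇒±1 : ∀ {a} → Q₅ a → a ≡ 1F ⊎ a ≡ 4F
Q₅⇒±1 (a≢0 , 0F , refl) with () ← a≢0 refl
Q₅⇒±1 (_ , 1F , refl) = inj₁ refl
Q₅⇒±1 (_ , 2F , refl) = inj₂ refl
Q₅⇒±1 (_ , 3F , refl) = inj₂ refl
Q₅⇒±1 (_ , 4F , refl) = inj₁ refl

Q₅-square : ∀ {a} → Q₅ a → a * a ≡ 1F
Q₅-square q with Q₅⇒±1 q
... | inj₁ refl = refl
... | inj₂ refl = refl

Q₅-self-orthogonal : {a : Vec ℤ₅ 5} → All Q₅ a → a · a ≡ 0F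
Q₅-self-orthogonal (p ∷ q ∷ r ∷ s ∷ t ∷ [])
  rewrite Q₅-square p | Q₅-square q | Q₅-square r | Q₅-square s | Q₅-square t
  = refl

-- Some k terms of xs, with suitable signs, add up to -s.
SignedSum : ℕ → ℤ₅ → List ℤ₅ → Set
SignedSum zero    s xs       = s ≡ 0F
SignedSum (suc k) s []       = ⊥
SignedSum (suc k) s (x ∷ xs) =
  SignedSum k (s + 1F * x) xs ⊎ SignedSum k (s + 4F * x) xs ⊎
  SignedSum (suc k) s xs

signedSum? : ∀ k s xs → Dec (SignedSum k s xs)
signedSum? zero    s xs       = s ≟ 0F
signedSum? (suc k) s []       = no λ ()
signedSum? (suc k) s (x ∷ xs) =
  signedSum? k (s + 1F * x) xs ⊎-dec signedSum? k (s + 4F * x) xs ⊎-dec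
  signedSum? (suc k) s xs

-- The disjuncts chosen along the list spell out the witnesses: take the head with weight 1, take it
-- with weight 4 = -1, or skip it. The sum `s` is arbitrary because each weighted head is absorbed
-- into it, and associativity moves that head back into `a · y`.
signedSum⇒weights : ∀ k s xs → SignedSum k s xs →
  ∃[ y ] toList y ⊆ xs × ∃[ a ] All Q₅ {k} a × s + a · y ≡ 0F
signedSum⇒weights zero s xs s≡0 =
  [] , minimum xs , [] , [] , trans (+-identityʳ s) s≡0
signedSum⇒weights (suc k) s (x ∷ xs) (inj₁ p) =
  let y , y⊆xs , a , qs , eq = signedSum⇒weights k _ xs p
  in x ∷ y , refl ∷ y⊆xs , 1F ∷ a , 1∈Q₅ ∷ qs , trans (sym (+-assoc s _ (a · y))) eq
signedSum⇒weights (suc k) s (x ∷ xs) (inj₂ (inj₁ p)) =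
  let y , y⊆xs , a , qs , eq = signedSum⇒weights k _ xs p
  in x ∷ y , refl ∷ y⊆xs , 4F ∷ a , 4∈Q₅ ∷ qs , trans (sym (+-assoc s _ (a · y))) eq
signedSum⇒weights (suc k) s (x ∷ xs) (inj₂ (inj₂ p)) =
  let y , y⊆xs , rest = signedSum⇒weights (suc k) s xs p
  in y , x ∷ʳ y⊆xs , rest

-- Completeness of the search, so that a negative answer of `signedSum?` excludes all weights: the
-- sublist proof decides between taking and skipping a head, and `Q₅⇒±1` decides its sign.
weights⇒signedSum : ∀ {k} s {xs} {y a : Vec ℤ₅ k} →
  toList y ⊆ xs → All Q₅ a → s + a · y ≡ 0F → SignedSum k s xs
weights⇒signedSum s {y = []} {[]} _ [] eq = trans (sym (+-identityʳ s)) eq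
weights⇒signedSum s {y = _ ∷ _} (x ∷ʳ y⊆xs) qs eq =
  inj₂ (inj₂ (weights⇒signedSum s y⊆xs qs eq))
weights⇒signedSum s {y = y₀ ∷ y} {_ ∷ a} (refl ∷ y⊆xs) (q ∷ qs) eq with Q₅⇒±1 q
... | inj₁ refl = inj₁ (weights⇒signedSum _ y⊆xs qs (trans (+-assoc s (1F * y₀) (a · y)) eq))
... | inj₂ refl = inj₂ (inj₁ (weights⇒signedSum _ y⊆xs qs (trans (+-assoc s (4F * y₀) (a · y)) eq)))

signedSum⇒hasWeightedZeroSum : ∀ {n} (x : Vec ℤ₅ n) →
  SignedSum 5 0F (toList x) → HasWeightedZeroSum₅ Q₅ Q₅ x
signedSum⇒hasWeightedZeroSum x p =
  let y , y⊆x , a , qs , eq = signedSum⇒weights 5 0F (toList x) p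
  in y , y⊆x , a , a , qs , qs ,
     trans (sym (+-identityˡ (a · y))) eq , Q₅-self-orthogonal qs

hasWeightedZeroSum⇒signedSum : ∀ {n} (x : Vec ℤ₅ n) →
  HasWeightedZeroSum₅ Q₅ Q₅ x → SignedSum 5 0F (toList x)
hasWeightedZeroSum⇒signedSum x (y , y⊆x , a , _ , qs , _ , eq , _) =
  weights⇒signedSum 0F y⊆x qs (trans (+-identityˡ (a · y)) eq)

infix 4 _≈±_

-- Negation is written as multiplication by `4F`, so that it combines with the weights `1F` and `4F`
-- through `*-assoc`.
_≈±_ : ℤ₅ → ℤ₅ → Set
x ≈± u = x ≡ u ⊎ x ≡ 4F * u

signedSum-resp-≈± : ∀ k s {xs us} → Pointwise _≈±_ xs us →
  SignedSum k s us → SignedSum k s xs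
signedSum-resp-≈± zero s _ s≡0 = s≡0
signedSum-resp-≈± (suc k) s (inj₁ refl ∷ rs) =
  ⊎.map (signedSum-resp-≈± k _ rs)
    (⊎.map (signedSum-resp-≈± k _ rs) (signedSum-resp-≈± (suc k) s rs))
-- A negated head is compensated by the opposite weight, so the first two disjuncts change places: 4
-- * 4 computes to 1, and 1 * 4 to 4.
signedSum-resp-≈± (suc k) s (_∷_ {y = u} (inj₂ refl) rs) = λ where
  (inj₁ p) → inj₂ (inj₁ (signedSum-resp-≈± k _ rs
    (subst (λ v → SignedSum k (s + v) _) (*-assoc 4F 4F u) p)))
  (inj₂ (inj₁ p)) → inj₁ (signedSum-resp-≈± k _ rs
    (subst (λ v → SignedSum k (s + v) _) (*-assoc 1F 4F u) p))
  (inj₂ (inj₂ p)) → inj₂ (inj₂ (signedSum-resp-≈± (suc k) s rs p))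

-- The classes of ℤ₅ up to sign are {0}, {1, 4} and {2, 3}, with least elements 0, 1 and 2.
rep : Fin 3 → ℤ₅
rep = _↑ˡ 2

representatives : ∀ {n} (x : Vec ℤ₅ n) → Σ[ c ∈ Vec (Fin 3) n ]
  Pointwise _≈±_ (toList x) (toList (map rep c))
representatives []      = [] , []
representatives (x ∷ xs) =
  let i , r = representative x ; c , rs = representatives xs in i ∷ c , r ∷ rs
  where
  representative : ∀ x → ∃[ i ] x ≈± rep i
  representative 0F = 0F , inj₁ refl
  representative 1F = 1F , inj₁ refl
  representative 2F = 2F , inj₁ refl
  representative 3F = 2F , inj₂ refl
  representative 4F = 1F , inj₂ refl

allVec? : ∀ {m p} n {P : Pred (Vec (Fin m) n) p} → Decidable P → Dec (∀ x → P x)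
allVec? zero    P? = map′ (λ { p [] → p }) (λ p → p []) (P? [])
allVec? (suc n) P? =
  map′ (λ { p (i ∷ x) → p i x }) (λ p i x → p (i ∷ x))
       (all? λ i → allVec? n λ x → P? (i ∷ x))

signedSum-5-of-7 : (x : Vec ℤ₅ 7) → SignedSum 5 0F (toList x)
signedSum-5-of-7 x =
  let c , x≈±c = representatives x
  in signedSum-resp-≈± 5 0F x≈±c (representatives-signedSum c)
  where
  representatives-signedSum :
    (c : Vec (Fin 3) 7) → SignedSum 5 0F (toList (map rep c))
  representatives-signedSum =
    from-yes (allVec? 7 λ c → signedSum? 5 0F (toList (map rep c)))

-- Five of the six terms include 1 or 2. With both, a signed sum is ±1 or ±3; with only one of them,
-- it is ±1 or ±2. None of these is 0 modulo 5.
extremal : Vec ℤ₅ 6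
extremal = 0F ∷ 0F ∷ 0F ∷ 0F ∷ 1F ∷ 2F ∷ []

truncate-⊆ : ∀ {A : Set} {m n} (m≤n : m ≤ n) (x : Vec A n) →
  toList (truncate m≤n x) ⊆ toList x
truncate-⊆ z≤n       x       = minimum (toList x)
truncate-⊆ (s≤s m≤n) (_ ∷ x) = refl ∷ truncate-⊆ m≤n x

-- A subsequence of an initial segment is a subsequence of `extremal`, so one refuted search at
-- length 6 settles every shorter length.
extremal-truncate-¬ : ∀ {j} (j≤6 : j ≤ 6) →
  ¬ HasWeightedZeroSum₅ Q₅ Q₅ (truncate j≤6 extremal)
extremal-truncate-¬ j≤6 (y , y⊆ , rest) =
  from-no (signedSum? 5 0F (toList extremal))
    (hasWeightedZeroSum⇒signedSum extremal
      (y , ⊆-trans y⊆ (truncate-⊆ j≤6 extremal) , rest))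

theorem5p2 : E[ Q₅ , Q₅ ]≡ 7
theorem5p2 =
    s≤s z≤n
  , (λ x → signedSum⇒hasWeightedZeroSum x (signedSum-5-of-7 x))
  , λ j _ P → ≮⇒≥ λ { (s≤s j≤6) → extremal-truncate-¬ j≤6 (P (truncate j≤6 extremal)) }
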